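{- Let $f(x_1,\ldots,x_n)$ be a satisfiable Boolean function of $n$ variables represented in conjunctive normal form with $m$ clauses. If the function $h(x_1,\ldots,x_n)$ is generated by the function $f(x_1,\ldots,x_n)$ as a result of extended admissible changes, then $h(x_1,\ldots,x_n)$ is a satisfiable function.
   Context: CNF conventions. A Boolean function $f(x_1,\ldots,x_n)$ in conjunctive normal form (CNF) with $m$ clauses is given as $f=\bigwedge_{i=1}^m c_i$, each clause being $c_i=x_{j_1}^{\alpha_1}\vee\cdots\vee x_{j_k}^{\alpha_k}$ with $k\in\{1,\ldots,n\}$, $\{j_1,\ldots,j_k\}\subseteq\{1,\ldots,n\}$, $\alpha_r\in\{0,1\}$, $x_j^0=\bar x_j$, $x_j^1=x_j$. Standing assumptions: no clause contains both a variable and its negation; every variable $x_j$, $j\in\{1,\ldots,n\}$, occurs (negated or not) in some clause. Clauses are numbered and identified with their numbers, so $S(f)=\{c_1,\ldots,c_m\}$ is an ordered set of $m$ elements. $f$ is satisfiable if $f(\sigma)=1$ for some $\sigma\in\{0,1\}^n$. Special decomposition and covering. For a nonempty ordered set $S=\{e_1,\ldots,e_m\}$, an ordered set $d_nS=\{(M_1^0,M_1^1),\ldots,(M_n^0,M_n^1)\}$ of ordered pairs of subsets of $S$ is a special decomposition of $S$ if for all $i$, $M_i^0\cap M_i^1=\emptyset$ and ($M_i^0\ne\emptyset$ or $M_i^1\neq\emptyset$), and $\bigcup_{i}(M_i^0\cup M_i^1)=S$. The ordered set $c_nS=\{M_1^{\alpha_1},\ldots,M_n^{\alpha_n}\}$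 is a special covering for $S$ under $d_nS$ if $\bigcup_i M_i^{\alpha_i}=S$. Decomposition generated by $f$. $d_nS(f)=\{(F_1^0,F_1^1),\ldots,(F_n^0,F_n^1)\}$, where $F_i^\alpha$ is the set of clauses $c_j\in S(f)$ containing the literal $x_i^\alpha$. When $f(\sigma_1,\ldots,\sigma_n)=1$, $\{F_1^{\sigma_1},\ldots,F_n^{\sigma_n}\}$ is the associated special covering $c_nS(f)$. Function generated by a special decomposition $d_nS$. $h=\bigwedge_{i=1}^m c_i'$, where $c_i'$ is the disjunction of the literals in $\{x_j^\alpha: e_i\in M_j^\alpha,\ j\in\{1,\ldots,n\},\ \alpha\in\{0,1\}\}$ (the first component of the $j$-th pair playing the role of $M_j^0$, the second that of $M_j^1$). Admissible changes under a tuple $(\alpha_1,\ldots,\alpha_n)$. Let $c_nS=\{M_1^{\alpha_1},\ldots,M_n^{\alpha_n}\}$ be a special covering under $d_nS$. Write $\bar\delta=1-\delta$; membership of $M_i^\delta$ in $c_nS$ means $\delta=\alpha_i$. The following changes are admissible: (i.1) for $e\in M_i^\delta$, replace $M_i^\delta$ by $M_i^\delta\setminus\{e\}$, if $M_i^\delta\notin c_nS$ and $(M_i^\delta\setminus\{e\})\cup M_i^{\bar\delta}\neq\emptyset$; (i.2) for $e\in S$ with $e\notin M_i^0\cup M_i^1$, replace $M_i^\delta$ by $M_i^\delta\cup\{e\}$; (i.3) if $M_j^\gamma$ and $M_i^\delta$ are both in $c_nS$, then for $e$ with $e\in M_j^\gamma$ and $e\notin M_i^{\bar\delta}$, replace $M_j^\gamma$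 by $M_j^\gamma\setminus\{e\}$ and $M_i^\delta$ by $M_i^\delta\cup\{e\}$. Changes are applied successively, each to the current pairs and with the current covering sets having the current tuple of superscripts. Extended admissible changes. To the admissible changes one adds the operation of permuting the components of an ordered pair, i.e. replacing $(M_i^0,M_i^1)$ by $(M_i^1,M_i^0)$ (the former $M_i^1$ becomes the first component, the former $M_i^0$ the second). If admissible changes are being performed under a tuple of superscripts $(\sigma_1,\ldots,\sigma_n)$ and the components of the $i$-th pair are permuted, then admissible changes continue under the tuple $(\sigma_1,\ldots,1-\sigma_i,\ldots,\sigma_n)$. The starting tuple is that of a special covering under the starting decomposition. Generation by extended admissible changes. For $f$ such that $f(\sigma_1,\ldots,\sigma_n)=1$ for some assignment tuple, $h$ is generated by $f$ as a result of extended admissible changes if a special decomposition is generated as a result of extended admissible changes in $d_nS(f)$ and $h$ is the function generated by that special decomposition. -}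

module Defs where

open import Data.Bool using (Bool; true; false; not; _∧_)
import Data.Bool.Properties as Bool
open import Data.Fin using (Fin)
import Data.Fin.Properties as Fin
open import Data.Fin.Subset using (Subset; _∈_; _∉_; _∩_; _∪_; _-_; ⁅_⁆; ⋃; ⊤; Empty; Nonempty)
open import Data.List using (List; []; any; tabulate)
import Data.List.Membership.Propositional as List
import Data.List.Membership.DecPropositional as DecMembership
open import Data.List.Relation.Unary.Unique.Propositional using (Unique)
open import Data.Nat using (ℕ; NonZero)
open import Data.Product using (_×_; _,_; proj₁; proj₂; map₁; map₂; swap; ∃-syntax)
open import Data.Product.Properties using (≡-dec)
open import Data.Sum using (_⊎_)
open import Data.Vec as Vec using (Vec; lookup; _[_]%=_)
open import Function using (_⇔_)
open import Relation.Binary.Construct.Closure.ReflexiveTransitive using (Star)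
open import Relation.Binary.Definitions using (DecidableEquality)
open import Relation.Binary.PropositionalEquality using (_≡_; _≢_)
open import Relation.Nullary using (¬_; does)

-- Superscripts and truth values 0 and 1 are the Booleans false and true.

-- (j , α) is the literal x_j^α.
Literal : ℕ → Set
Literal n = Fin n × Bool

_≟ˡ_ : ∀ {n} → DecidableEquality (Literal n)
_≟ˡ_ = ≡-dec Fin._≟_ Bool._≟_

Clause : ℕ → Set
Clause n = List (Literal n)

-- n variables, m clauses; a clause is identified with its number in Fin m.
CNF : ℕ → ℕ → Set
CNF n m = Vec (Clause n) m

-- The number of literals in a clause is at most n, as a consequence of
-- `distinct` and `consistent`.
record StandingAssumptions {n m : ℕ} (f : CNF n m) : Set where
  field
    nonempty   : ∀ i → lookup f i ≢ []
    distinct   : ∀ i → Unique (lookup f i)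
    consistent : ∀ i j → ¬ ((j , false) List.∈ lookup f i × (j , true) List.∈ lookup f i)
    occurs     : ∀ j → ∃[ i ] ∃[ α ] (j , α) List.∈ lookup f i

Tuple : ℕ → Set
Tuple n = Vec Bool n

evalLiteral : ∀ {n} → Tuple n → Literal n → Bool
evalLiteral σ (j , true)  = lookup σ j
evalLiteral σ (j , false) = not (lookup σ j)

evalClause : ∀ {n} → Tuple n → Clause n → Bool
evalClause σ c = any (evalLiteral σ) c

eval : ∀ {n m} → CNF n m → Tuple n → Bool
eval f σ = Vec.foldr _ (λ c b → evalClause σ c ∧ b) true f

Satisfiable : ∀ {n m} → CNF n m → Set
Satisfiable f = ∃[ σ ] eval f σ ≡ true

-- S is Fin m; the i-th entry is the ordered pair (M_i^0 , M_i^1).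
Pairs : ℕ → ℕ → Set
Pairs n m = Vec (Subset m × Subset m) n

component : ∀ {A : Set} → Bool → A × A → A
component false = proj₁
component true  = proj₂

mapComponent : ∀ {A : Set} → Bool → (A → A) → A × A → A × A
mapComponent false g = map₁ g
mapComponent true  g = map₂ g

-- part d i α is M_i^α.
part : ∀ {n m} → Pairs n m → Fin n → Bool → Subset m
part d i α = component α (lookup d i)

record IsSpecialDecomposition {n m : ℕ} (d : Pairs n m) : Set where
  field
    S-nonempty : NonZero m
    disjoint   : ∀ i → Empty (part d i false ∩ part d i true)
    nonempty   : ∀ i → Nonempty (part d i false) ⊎ Nonempty (part d i true)
    exhaustive : ⋃ (tabulate λ i → part d i false ∪ part d i true) ≡ ⊤

IsSpecialCovering : ∀ {n m} → Pairs n m → Tuple n → Set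
IsSpecialCovering d α = ⋃ (tabulate λ i → part d i (lookup α i)) ≡ ⊤

-- F_i^α is the set of (numbers of) clauses of f containing x_i^α.
decomposition : ∀ {n m} → CNF n m → Pairs n m
decomposition {n} f = Vec.tabulate λ i → F i false , F i true
  where
  open DecMembership (_≟ˡ_ {n}) using (_∈?_)
  F : Fin n → Bool → Subset _
  F i α = Vec.map (λ c → does ((i , α) ∈? c)) f

-- h is the function generated by d: its e-th clause is the disjunction of the
-- literals x_j^α with e ∈ M_j^α. The order in which a clause lists its
-- literals is left open.
IsGeneratedFrom : ∀ {n m} → CNF n m → Pairs n m → Set
IsGeneratedFrom h d = ∀ e j α → ((j , α) List.∈ lookup h e) ⇔ (e ∈ part d j α)

-- One admissible change under the tuple α. The set M_i^δ belongs to the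
-- covering exactly when δ is the i-th superscript of α. In `move`, the case
-- j = i is not excluded; it leaves the pairs unchanged.
data AdmissibleChange {n m : ℕ} (α : Tuple n) (d : Pairs n m) : Pairs n m → Set where
  remove : ∀ i δ e →
    e ∈ part d i δ →
    δ ≢ lookup α i →
    Nonempty ((part d i δ - e) ∪ part d i (not δ)) →
    AdmissibleChange α d (d [ i ]%= mapComponent δ (_- e))
  add : ∀ i δ e →
    e ∉ part d i false ∪ part d i true →
    AdmissibleChange α d (d [ i ]%= mapComponent δ (_∪ ⁅ e ⁆))
  move : ∀ j γ i δ e →
    γ ≡ lookup α j →
    δ ≡ lookup α i →
    e ∈ part d j γ →
    e ∉ part d i (not δ) →
    AdmissibleChange α d
      ((d [ j ]%= mapComponent γ (_- e)) [ i ]%= mapComponent δ (_∪ ⁅ e ⁆))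

-- Current pairs together with the current tuple of superscripts.
State : ℕ → ℕ → Set
State n m = Pairs n m × Tuple n

data ExtendedChange {n m : ℕ} : State n m → State n m → Set where
  admissible : ∀ {d d′ α} → AdmissibleChange α d d′ → ExtendedChange (d , α) (d′ , α)
  permute    : ∀ {d α} i → ExtendedChange (d , α) (d [ i ]%= swap , α [ i ]%= not)

-- Intermediate pairs need not form a special decomposition (`move` may empty
-- both components of a pair); the final ones must.
GeneratedBy : ∀ {n m} → CNF n m → CNF n m → Set
GeneratedBy f h =
  ∃[ σ ] IsSpecialCovering (decomposition f) σ ×
  ∃[ d ] ∃[ τ ] Star ExtendedChange (decomposition f , σ) (d , τ) ×
  IsSpecialDecomposition d ×
  IsGeneratedFrom h d

{-# OPTIONS --safe #-}

-- The sets selected by the current tuple cover S at every stage: an admissible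
-- change removes an element from a selected set only to put it in another
-- selected set, and a permutation selects the same set as before. For the
-- final pairs, coverage of the e-th element by the i-th selected set says that
-- the literal x_i^{τ_i}, true under τ, occurs in the e-th clause of h; hence
-- the final tuple τ satisfies h.

module Submission where

open import Defs
open import Data.Bool using (Bool; true; false; not; T)
open import Data.Bool.Properties using (T-≡)
open import Data.Empty using (⊥-elim)
open import Data.Fin using (Fin; zero; suc)
import Data.Fin.Properties as Fin
open import Data.Fin.Subset using (Subset; _∈_; _∪_; _-_; ⁅_⁆; ⋃)
open import Data.Fin.Subset.Properties
  using (∈⊤; ∉⊥; x∈⁅x⁆; x∈p∪q⁻; x∈p∪q⁺; x∈p∧x≢y⇒x∈p-y)
open import Data.List using (List; []; _∷_)
import Data.List.Membership.Propositional as List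
open import Data.List.Relation.Unary.Any as Any using (Any; here; there)
open import Data.List.Relation.Unary.Any.Properties using (any⁺; tabulate⁻)
open import Data.Nat using (ℕ)
open import Data.Product using (_×_; _,_; ∃-syntax; swap)
open import Data.Sum using (inj₁; inj₂)
open import Data.Vec using ([]; _∷_; lookup; _[_]%=_)
open import Data.Vec.Properties using (lookup∘updateAt; lookup∘updateAt′)
open import Function using (_∘_; Equivalence)
open import Relation.Binary.Construct.Closure.ReflexiveTransitive using (Star; ε; _◅_)
open import Relation.Binary.PropositionalEquality
  using (_≡_; refl; sym; trans; cong; subst)
open import Relation.Nullary using (yes; no)

private
  variable
    n m : ℕ

-- Records which member of the list contains the element, so that `tabulate⁻` can recover the index
-- of a selected set.
∈⋃⇒Any : ∀ {x : Fin m} (ps : List (Subset m)) → x ∈ ⋃ ps → Any (x ∈_) ps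
∈⋃⇒Any []       x∈ = ⊥-elim (∉⊥ x∈)
∈⋃⇒Any (p ∷ ps) x∈ with x∈p∪q⁻ p (⋃ ps) x∈
... | inj₁ x∈p  = here x∈p
... | inj₂ x∈ps = there (∈⋃⇒Any ps x∈ps)

-- Pointwise form of `IsSpecialCovering`: a change displaces a single element, so coverage is
-- tracked element by element.
Covers : Pairs n m → Tuple n → Set
Covers d α = ∀ e → ∃[ i ] e ∈ part d i (lookup α i)

specialCovering⇒covers : ∀ (d : Pairs n m) α → IsSpecialCovering d α → Covers d α
specialCovering⇒covers d α covering e =
  tabulate⁻ (∈⋃⇒Any _ (subst (e ∈_) (sym covering) ∈⊤))

component-mapComponent : ∀ {A : Set} δ (g : A → A) p →
  component δ (mapComponent δ g p) ≡ g (component δ p)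
component-mapComponent false g p = refl
component-mapComponent true  g p = refl

part-mapComponent : ∀ (d : Pairs n m) i δ g →
  part (d [ i ]%= mapComponent δ g) i δ ≡ g (part d i δ)
part-mapComponent d i δ g =
  trans (cong (component δ) (lookup∘updateAt i d))
        (component-mapComponent δ g (lookup d i))

∈-mapComponent : ∀ {A : Set} (P : A → Set) δ γ (g : A → A) p →
  (δ ≡ γ → P (component γ p) → P (g (component γ p))) →
  P (component γ p) → P (component γ (mapComponent δ g p))
∈-mapComponent P false false g p keep = keep refl
∈-mapComponent P false true  g p keep Pp = Pp
∈-mapComponent P true  false g p keep Pp = Pp
∈-mapComponent P true  true  g p keep = keep refl

-- Membership can be lost only in the updated component of the updated pair. Hence `keep` receives
-- both equations, which a caller may refute instead of proving survival.
∈-part-mapComponent : ∀ (d : Pairs n m) i δ g {x} k γ →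
  (i ≡ k → δ ≡ γ → x ∈ part d k γ → x ∈ g (part d k γ)) →
  x ∈ part d k γ → x ∈ part (d [ i ]%= mapComponent δ g) k γ
∈-part-mapComponent d i δ g {x} k γ keep x∈ with k Fin.≟ i
... | no k≢i =
  subst (λ p → x ∈ component γ p) (sym (lookup∘updateAt′ k i k≢i d)) x∈
... | yes refl =
  subst (λ p → x ∈ component γ p) (sym (lookup∘updateAt k d))
    (∈-mapComponent (x ∈_) δ γ g (lookup d k) (keep refl) x∈)

admissible-covers : ∀ {α : Tuple n} {d d′ : Pairs n m} →
  AdmissibleChange α d d′ → Covers d α → Covers d′ α
admissible-covers {α = α} {d} (remove i δ e _ δ≢αᵢ _) covers x with covers x
... | k , x∈ =
  k , ∈-part-mapComponent d i δ (_- e) k (lookup α k)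
        -- The deletion acts on an unselected set, so it never meets the set that covers `x`.
        (λ { refl δ≡αᵢ → ⊥-elim (δ≢αᵢ δ≡αᵢ) }) x∈
admissible-covers {α = α} {d} (add i δ e _) covers x with covers x
... | k , x∈ =
  k , ∈-part-mapComponent d i δ (_∪ ⁅ e ⁆) k (lookup α k)
        (λ _ _ → x∈p∪q⁺ ∘ inj₁) x∈
admissible-covers {α = α} {d} (move j γ i δ e _ refl _ _) covers x with x Fin.≟ e
... | yes refl =
  -- The moved element is covered by the receiving set. This includes `j` equal to `i`, since the
  -- insertion follows the deletion.
  i , subst (x ∈_) (sym (part-mapComponent (d [ j ]%= mapComponent γ (_- x)) i δ (_∪ ⁅ x ⁆)))
        (x∈p∪q⁺ (inj₂ (x∈⁅x⁆ x)))
... | no x≢e with covers x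
... | k , x∈ =
  -- Any other element keeps its index: the insertion only enlarges a set, and the deletion removes
  -- only `e`.
  k , ∈-part-mapComponent (d [ j ]%= mapComponent γ (_- e)) i δ (_∪ ⁅ e ⁆) k (lookup α k)
        (λ _ _ → x∈p∪q⁺ ∘ inj₁)
        (∈-part-mapComponent d j γ (_- e) k (lookup α k)
          (λ _ _ x∈p → x∈p∧x≢y⇒x∈p-y x∈p x≢e) x∈)

component-swap : ∀ {A : Set} α (p : A × A) → component (not α) (swap p) ≡ component α p
component-swap false p = refl
component-swap true  p = refl

-- At index `i` the swap and the negation cancel; at any other index neither acts.
part-permute : ∀ (d : Pairs n m) α i k →
  part (d [ i ]%= swap) k (lookup (α [ i ]%= not) k) ≡ part d k (lookup α k)
part-permute d α i k with k Fin.≟ i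
... | no k≢i
  rewrite lookup∘updateAt′ k i {f = swap} k≢i d
        | lookup∘updateAt′ k i {f = not} k≢i α = refl
... | yes refl
  rewrite lookup∘updateAt k {f = swap} d
        | lookup∘updateAt k {f = not} α = component-swap (lookup α k) (lookup d k)

extended-covers : ∀ {d d′ : Pairs n m} {α α′} →
  ExtendedChange (d , α) (d′ , α′) → Covers d α → Covers d′ α′
extended-covers (admissible change) covers = admissible-covers change covers
extended-covers {d = d} {α = α} (permute i) covers x with covers x
... | k , x∈ = k , subst (x ∈_) (sym (part-permute d α i k)) x∈

extended*-covers : ∀ {d d′ : Pairs n m} {α α′} →
  Star ExtendedChange (d , α) (d′ , α′) → Covers d α → Covers d′ α′
extended*-covers ε                  covers = covers
extended*-covers (change ◅ changes) covers =
  extended*-covers changes (extended-covers change covers)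

evalLiteral-lookup : ∀ (τ : Tuple n) j → T (evalLiteral τ (j , lookup τ j))
evalLiteral-lookup τ j with lookup τ j in eq
-- Unfolding `evalLiteral` exposes `lookup τ j` again, and `eq` replaces it by its value.
... | true  rewrite eq = _
... | false rewrite eq = _

evalClause-true : ∀ (τ : Tuple n) {c j} → (j , lookup τ j) List.∈ c → evalClause τ c ≡ true
evalClause-true τ {j = j} l∈c = Equivalence.to T-≡
  (any⁺ (evalLiteral τ) (Any.map (λ { refl → evalLiteral-lookup τ j }) l∈c))

eval-true : ∀ (h : CNF n m) τ → (∀ e → evalClause τ (lookup h e) ≡ true) → eval h τ ≡ true
eval-true []      τ clauses = refl
eval-true (c ∷ h) τ clauses rewrite clauses zero = eval-true h τ (clauses ∘ suc)

covers⇒eval-true : ∀ (h : CNF n m) d τ → IsGeneratedFrom h d → Covers d τ → eval h τ ≡ true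
covers⇒eval-true h d τ generated covers = eval-true h τ λ e →
  let j , e∈ = covers e in
  evalClause-true τ (Equivalence.from (generated e j (lookup τ j)) e∈)

theorem6p5 : ∀ {n m : ℕ} (f h : CNF n m) → StandingAssumptions f →
    Satisfiable f → GeneratedBy f h → Satisfiable h
theorem6p5 f h _ _ (σ , covering , d , τ , changes , _ , generated) =
  -- Permutations flip superscripts, so the satisfying assignment is the final tuple `τ` rather than
  -- `σ`.
  τ , covers⇒eval-true h d τ generated
        (extended*-covers changes (specialCovering⇒covers (decomposition f) σ covering))
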